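{- The Heawood graph is $4$-ordered hamiltonian.
   Context: A simple graph $G$ is called $k$-ordered hamiltonian if for every sequence $v_1,\ldots,v_k$ of $k$ distinct vertices of $G$ there exists a hamiltonian cycle in $G$ (a cycle through all vertices) containing these $k$ vertices in the specified (cyclic) order. The Heawood graph is the $3$-regular bipartite graph on $14$ vertices given by the point–line incidence graph of the Fano plane; equivalently, it is the graph with vertices $0,1,\ldots,13$ forming a hamiltonian cycle $0-1-2-\cdots-13-0$, together with the chords joining $i$ and $i+5 \pmod{14}$ for every even $i$. -}

module Defs where

open import Data.Fin.Base using (Fin; toℕ; _<_)
open import Data.Fin.Properties using (_≟_; all?)
open import Data.Nat.Base using (ℕ; _+_; NonZero)
open import Data.Nat.Divisibility using (_∣_)
open import Data.Nat.DivMod using (_mod_)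
open import Data.Product.Base using (_×_; _,_; Σ-syntax)
open import Data.Sum.Base using (_⊎_; inj₁; inj₂)
open import Function.Bundles using (_⤖_; module Bijection)
open import Function.Definitions using (Injective)
open import Level using (0ℓ)
open import Relation.Binary.Construct.Closure.Symmetric
  using (SymClosure; fwd; bwd; symmetric)
open import Relation.Binary.Core using (Rel; _Preserves_⟶_)
open import Relation.Binary.Definitions using (Symmetric; Irreflexive)
open import Relation.Binary.PropositionalEquality.Core using (_≡_; _≢_; refl)
open import Relation.Nullary.Negation.Core using (¬_)
open import Relation.Nullary.Decidable using (toWitness; ¬?)

-- Addition modulo n.
_⊕_ : ∀ {n} .{{_ : NonZero n}} → Fin n → ℕ → Fin n
_⊕_ {n} i j = (toℕ i + j) mod n

record SimpleGraph (V : Set) : Set₁ where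
  field
    Adjacent     : Rel V 0ℓ
    adjacent-sym : Symmetric Adjacent
    no-loops     : Irreflexive _≡_ Adjacent

-- A hamiltonian cycle is given by a closed traversal of it: an enumeration
-- x₀, x₁, …, xₙ₋₁ of all the vertices, without repetition, in which cyclically
-- consecutive vertices are adjacent. As for every cycle of a simple graph,
-- n ≥ 3; without this a single edge traversed back and forth would qualify.
-- A traversal fixes a starting point and a direction, which the cycle itself
-- does not have: 'InCyclicOrder' quantifies over the starting point, and the
-- two directions are two inhabitants of this type.
record HamiltonianCycle {V : Set} (G : SimpleGraph V) : Set where
  open SimpleGraph G
  field
    n-3 : ℕ

  n : ℕ
  n = 3 + n-3

  field
    traversal : Fin n ⤖ V

  vertex : Fin n → V
  vertex = Bijection.to traversal

  field
    consecutive : ∀ i → Adjacent (vertex i) (vertex (i ⊕ 1))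

-- Going once around the cycle from a suitable starting point, the vertices
-- v 0, v 1, …, v (k - 1) are met in this order (other vertices may intervene).
InCyclicOrder : ∀ {V : Set} {G : SimpleGraph V} {k} →
                HamiltonianCycle G → (Fin k → V) → Set
InCyclicOrder {k = k} C v =
  Σ[ start ∈ Fin n ] Σ[ offset ∈ (Fin k → Fin n) ]
    (offset Preserves _<_ ⟶ _<_) ×
    (∀ i → vertex (start ⊕ toℕ (offset i)) ≡ v i)
  where open HamiltonianCycle C

_-OrderedHamiltonian_ : ∀ {V : Set} → ℕ → SimpleGraph V → Set
_-OrderedHamiltonian_ {V} k G =
  (v : Fin k → V) → Injective _≡_ _≡_ v →
  Σ[ C ∈ HamiltonianCycle G ] InCyclicOrder C v

HeawoodEdge : Rel (Fin 14) 0ℓ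
HeawoodEdge i j = (j ≡ i ⊕ 1) ⊎ ((2 ∣ toℕ i) × (j ≡ i ⊕ 5))

heawood : SimpleGraph (Fin 14)
heawood = record
  { Adjacent     = SymClosure HeawoodEdge
  ; adjacent-sym = symmetric HeawoodEdge
  ; no-loops     = λ { refl (fwd e) → irrefl e ; refl (bwd e) → irrefl e }
  }
  where
  ≢⊕1 : ∀ (i : Fin 14) → i ≢ i ⊕ 1
  ≢⊕1 = toWitness {a? = all? λ i → ¬? (i ≟ (i ⊕ 1))} _

  ≢⊕5 : ∀ (i : Fin 14) → i ≢ i ⊕ 5
  ≢⊕5 = toWitness {a? = all? λ i → ¬? (i ≟ (i ⊕ 5))} _

  irrefl : ∀ {i} → ¬ HeawoodEdge i i
  irrefl (inj₁ e)       = ≢⊕1 _ e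
  irrefl (inj₂ (_ , e)) = ≢⊕5 _ e

{-# OPTIONS --safe #-}

-- The Heawood graph has so many automorphisms that only two hamiltonian
-- traversals are needed: 0, 1, …, 13 and its reverse 0, 13, …, 1. Being met in
-- order by some hamiltonian cycle is invariant under automorphisms, so it is
-- enough to move every sequence of four vertices, by a product of involutive
-- automorphisms, to one that one of the two traversals meets in order. The
-- first vertex is moved to 0, and then the remaining three are put in order by
-- automorphisms fixing 0; both steps are finite checks.
module Submission where

open import Defs

open import Data.Fin.Base using (Fin; zero; suc; toℕ; _<_; opposite)
open import Data.Fin.Patterns using (0F; 1F; 2F; 3F)
open import Data.Fin.Properties using (_≟_; _<?_; all?; <-trans; toℕ<n; toℕ-injective; toℕ-fromℕ<)
open import Data.List.Base using (List; []; _∷_)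
open import Data.Nat.Base using (ℕ; _∸_; s≤s)
open import Data.Nat.DivMod using (_mod_; m<n⇒m%n≡m; m%n<n)
open import Data.Nat.Divisibility using (_∣?_)
open import Data.Product.Base using (_×_; _,_; Σ-syntax)
open import Data.Sum.Base using (_⊎_; inj₁; inj₂; [_,_])
open import Data.Vec.Base using (Vec; []; _∷_; lookup; map)
open import Function.Base using (_∘_; id)
open import Function.Bundles using (_⤖_; mk↔ₛ′)
open import Function.Construct.Composition using (_⤖-∘_)
open import Function.Definitions using (Injective)
open import Function.Properties.Inverse using (↔⇒⤖)
open import Level using (0ℓ)
open import Relation.Binary.Construct.Closure.Symmetric using (fwd; bwd)
open import Relation.Binary.Core using (_Preserves_⟶_)
open import Relation.Binary.Definitions using (Decidable)
open import Relation.Binary.PropositionalEquality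
  using (_≡_; _≢_; refl; sym; trans; cong; subst)
open import Relation.Nullary.Decidable
  using (Dec; True; toWitness; map′; ¬?; _×-dec_; _⊎-dec_; _→-dec_)
open import Relation.Unary using (Pred)
import Relation.Unary as Unary

MetInOrder : ∀ {V : Set} {k} → SimpleGraph V → (Fin k → V) → Set
MetInOrder G v = Σ[ C ∈ HamiltonianCycle G ] InCyclicOrder C v

involution-⤖ : ∀ {A : Set} (f : A → A) → (∀ x → f (f x) ≡ x) → A ⤖ A
involution-⤖ f f-inv = ↔⇒⤖ (mk↔ₛ′ f f f-inv f-inv)

-- With order two the map is its own inverse, so `involutive` alone gives bijectivity and one
-- direction of `adjacent` already makes an automorphism.
record Reflection {V : Set} (G : SimpleGraph V) : Set where
  open SimpleGraph G
  field
    to         : V → V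
    involutive : ∀ x → to (to x) ≡ x
    adjacent   : ∀ x y → Adjacent x y → Adjacent (to x) (to y)

  to-injective : Injective _≡_ _≡_ to
  to-injective {x} {y} eq =
    trans (sym (involutive x)) (trans (cong to eq) (involutive y))

open Reflection using (to; to-injective)

module _ {V : Set} {G : SimpleGraph V} where

  -- Take the image under `σ` of the cycle through `to σ ∘ v`: start and offsets stay the same, and
  -- `σ` applied twice gives back `v`.
  metInOrder-reflect : ∀ {k} {v : Fin k → V} (σ : Reflection G) →
                       MetInOrder G (to σ ∘ v) → MetInOrder G v
  metInOrder-reflect {v = v} σ (C , start , offset , increasing , met) =
    record
      { n-3         = n-3
      ; traversal   = involution-⤖ (to σ) involutive ⤖-∘ traversal
      ; consecutive = λ i → adjacent _ _ (consecutive i)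
      }
    , start , offset , increasing
    , λ i → trans (cong (to σ) (met i)) (involutive (v i))
    where
    open HamiltonianCycle C
    open Reflection σ using (involutive; adjacent)

  -- The product is taken over a sublist, with the head acting first.
  data AfterSome (P : Pred (V → V) 0ℓ) : List (Reflection G) → Pred (V → V) 0ℓ where
    done  : ∀ {f} → P f → AfterSome P [] f
    skip  : ∀ {σ σs f} → AfterSome P σs f → AfterSome P (σ ∷ σs) f
    apply : ∀ {σ σs f} → AfterSome P σs (to σ ∘ f) → AfterSome P (σ ∷ σs) f

  afterSome? : ∀ {P} → Unary.Decidable P → ∀ σs → Unary.Decidable (AfterSome P σs)
  afterSome? P? []       f = map′ done (λ { (done p) → p }) (P? f)
  afterSome? P? (σ ∷ σs) f =
    map′ [ skip , apply ] (λ { (skip p) → inj₁ p ; (apply p) → inj₂ p })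
      (afterSome? P? σs f ⊎-dec afterSome? P? σs (to σ ∘ f))

  -- Each applied reflection is undone on the way back by `metInOrder-reflect`. Injectivity is
  -- carried along so that `met` can still tell the entries of `τ ∘ v` apart.
  metInOrder-afterSome : ∀ {k} {v : Fin k → V} {P σs f} → Injective _≡_ _≡_ f →
    (∀ τ → Injective _≡_ _≡_ τ → P τ → MetInOrder G (τ ∘ v)) →
    AfterSome P σs f → MetInOrder G (f ∘ v)
  metInOrder-afterSome f-inj met (done p)          = met _ f-inj p
  metInOrder-afterSome f-inj met (skip p)          = metInOrder-afterSome f-inj met p
  metInOrder-afterSome f-inj met (apply {σ = σ} p) =
    metInOrder-reflect σ (metInOrder-afterSome (f-inj ∘ to-injective σ) met p)

Increasing : ∀ {n} → (Fin n → Fin n) → (a b c d : Fin n) → Set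
Increasing f a b c d = f a < f b × f b < f c × f c < f d

increasing? : ∀ {n} f (a b c d : Fin n) → Dec (Increasing f a b c d)
increasing? f a b c d = f a <? f b ×-dec f b <? f c ×-dec f c <? f d

increasing-preserves : ∀ {n} f (v : Fin 4 → Fin n) →
  Increasing f (v 0F) (v 1F) (v 2F) (v 3F) → (f ∘ v) Preserves _<_ ⟶ _<_
increasing-preserves f v (p , q , r) {0F} {1F} _ = p
increasing-preserves f v (p , q , r) {0F} {2F} _ = <-trans p q
increasing-preserves f v (p , q , r) {0F} {3F} _ = <-trans (<-trans p q) r
increasing-preserves f v (p , q , r) {1F} {2F} _ = q
increasing-preserves f v (p , q , r) {1F} {3F} _ = <-trans q r
increasing-preserves f v (p , q , r) {2F} {3F} _ = r
increasing-preserves f v _ {1F} {1F} (s≤s ())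
increasing-preserves f v _ {suc (suc _)} {1F} (s≤s ())
increasing-preserves f v _ {suc (suc _)} {2F} (s≤s (s≤s ()))
increasing-preserves f v _ {3F} {3F} (s≤s (s≤s (s≤s ())))

0⊕toℕ : ∀ {n} (i : Fin (ℕ.suc n)) → zero {n} ⊕ toℕ i ≡ i
0⊕toℕ i = toℕ-injective
  (trans (toℕ-fromℕ< (m%n<n (toℕ i) _)) (m<n⇒m%n≡m (toℕ<n i)))

heawoodEdge? : Decidable HeawoodEdge
heawoodEdge? i j = j ≟ (i ⊕ 1) ⊎-dec (2 ∣? toℕ i ×-dec j ≟ (i ⊕ 5))

open SimpleGraph heawood using (Adjacent)

adjacent? : Decidable Adjacent
adjacent? i j = map′ [ fwd , bwd ] (λ { (fwd e) → inj₁ e ; (bwd e) → inj₂ e })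
  (heawoodEdge? i j ⊎-dec heawoodEdge? j i)

involutive? : ∀ {n} (f : Fin n → Fin n) → Dec (∀ i → f (f i) ≡ i)
involutive? f = all? λ i → f (f i) ≟ i

-- Since `f` is an involution, `f x` is also the position of the vertex `x` in the traversal `f`;
-- hence the offsets `f ∘ v` from start 0.
increasing⇒metInOrder : ∀ (f : Fin 14 → Fin 14) (v : Fin 4 → Fin 14) →
  (∀ i → f (f i) ≡ i) → (∀ i → Adjacent (f i) (f (i ⊕ 1))) →
  Increasing f (v 0F) (v 1F) (v 2F) (v 3F) → MetInOrder heawood v
increasing⇒metInOrder f v f-inv f-adj incr =
  record { n-3 = 11 ; traversal = involution-⤖ f f-inv ; consecutive = f-adj }
  , zero , f ∘ v , increasing-preserves f v incr
  , λ i → trans (cong f (0⊕toℕ (f (v i)))) (f-inv (v i))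

-- The reduction matters only at 0, which it keeps fixed. This map preserves the rim but not the
-- chords, so it serves as a traversal and not as a `Reflection`.
negate : Fin 14 → Fin 14
negate i = (14 ∸ toℕ i) mod 14

Monotone : (f : Fin 14 → Fin 14) (a b c d : Fin 14) → Set
Monotone f a b c d =
  Increasing id (f a) (f b) (f c) (f d) ⊎ Increasing negate (f a) (f b) (f c) (f d)

monotone? : ∀ f a b c d → Dec (Monotone f a b c d)
monotone? f a b c d = increasing? id (f a) (f b) (f c) (f d)
  ⊎-dec increasing? negate (f a) (f b) (f c) (f d)

monotone⇒metInOrder : ∀ f (v : Fin 4 → Fin 14) →
  Monotone f (v 0F) (v 1F) (v 2F) (v 3F) → MetInOrder heawood (f ∘ v)
monotone⇒metInOrder f v =
  [ increasing⇒metInOrder id (f ∘ v) (λ _ → refl) (λ _ → fwd (inj₁ refl))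
  , increasing⇒metInOrder negate (f ∘ v)
      (toWitness {a? = involutive? negate} _)
      (toWitness {a? = all? λ i → adjacent? (negate i) (negate (i ⊕ 1))} _)
  ]

reflection : (f : Fin 14 → Fin 14) → {True (involutive? f)} →
  {True (all? λ i → all? λ j → adjacent? i j →-dec adjacent? (f i) (f j))} →
  Reflection heawood
reflection f {inv} {adj} = record
  { to = f ; involutive = toWitness inv ; adjacent = toWitness adj }

permutation : Vec ℕ 14 → Fin 14 → Fin 14
permutation xs = lookup (map (_mod 14) xs)

-- With even vertices as points and odd ones as lines, `ρ` is a polarity of the Fano plane, while
-- `α`, `β`, `γ` are collineations fixing the point 0.
ρ α β γ : Reflection heawood
ρ = reflection opposite
α = reflection (permutation
  (0 ∷ 1 ∷ 2 ∷ 3 ∷ 12 ∷ 13 ∷ 8 ∷ 7 ∷ 6 ∷ 11 ∷ 10 ∷ 9 ∷ 4 ∷ 5 ∷ []))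
β = reflection (permutation
  (0 ∷ 1 ∷ 10 ∷ 9 ∷ 4 ∷ 5 ∷ 6 ∷ 11 ∷ 12 ∷ 3 ∷ 2 ∷ 7 ∷ 8 ∷ 13 ∷ []))
γ = reflection (permutation
  (0 ∷ 13 ∷ 8 ∷ 9 ∷ 4 ∷ 5 ∷ 6 ∷ 7 ∷ 2 ∷ 3 ∷ 12 ∷ 11 ∷ 10 ∷ 1 ∷ []))

-- Found by computer search. The sublists of the second word yield 20 of the 24
-- automorphisms fixing 0, which suffice.
transitiveWord stabilizerWord : List (Reflection heawood)
transitiveWord = ρ ∷ α ∷ γ ∷ ρ ∷ α ∷ γ ∷ ρ ∷ []
stabilizerWord = α ∷ β ∷ γ ∷ α ∷ β ∷ []

moveToZero : ∀ a → AfterSome (λ f → f a ≡ 0F) transitiveWord id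
moveToZero = toWitness
  {a? = all? λ a → afterSome? (λ f → f a ≟ 0F) transitiveWord id} _

sortFromZero : ∀ b → 0F ≢ b → ∀ c → 0F ≢ c → b ≢ c →
  ∀ d → 0F ≢ d → b ≢ d → c ≢ d →
  AfterSome (λ f → Monotone f 0F b c d) stabilizerWord id
sortFromZero = toWitness
  -- Each distinctness test precedes the next quantifier, so degenerate choices are discarded before
  -- the inner enumeration.
  {a? = all? λ b → ¬? (0F ≟ b) →-dec
        all? λ c → ¬? (0F ≟ c) →-dec ¬? (b ≟ c) →-dec
        all? λ d → ¬? (0F ≟ d) →-dec ¬? (b ≟ d) →-dec ¬? (c ≟ d) →-dec
        afterSome? (λ f → monotone? f 0F b c d) stabilizerWord id} _

theorem3p3 : 4 -OrderedHamiltonian heawood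
theorem3p3 v v-inj = metInOrder-afterSome id fromZero (moveToZero (v 0F))
  where
  fromZero : ∀ τ → Injective _≡_ _≡_ τ → τ (v 0F) ≡ 0F → MetInOrder heawood (τ ∘ v)
  -- The second search restarts from `id` on the sequence `τ ∘ v`, whose first entry is 0, as
  -- `sortFromZero` assumes.
  fromZero τ τ-inj τv₀≡0 = metInOrder-afterSome id
    (λ f _ → monotone⇒metInOrder f (τ ∘ v) ∘
             subst (λ a → Monotone f a (τ (v 1F)) (τ (v 2F)) (τ (v 3F))) (sym τv₀≡0))
    (sortFromZero _ (0≢ λ ()) _ (0≢ λ ()) (distinct λ ())
                  _ (0≢ λ ()) (distinct λ ()) (distinct λ ()))
    where
    distinct : ∀ {i j} → i ≢ j → τ (v i) ≢ τ (v j)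
    distinct i≢j eq = i≢j (v-inj (τ-inj eq))

    0≢ : ∀ {i} → 0F ≢ i → 0F ≢ τ (v i)
    0≢ 0≢i eq = distinct 0≢i (trans τv₀≡0 eq)
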